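{- Let $t\ge 2$ and $r\ge 3$ be integers and let $m=r-1$. Then \[ \frac{m^{t-1}}{3\sqrt t}\;\le\;\tilde R_t(P_r^{(2)})\;\le\; t\,m^{t+1}. \]
   Context: An ordered ($k$-uniform) hypergraph is a $k$-uniform hypergraph whose vertex set is linearly ordered; a copy of an ordered hypergraph $G$ in an ordered hypergraph $H$ must respect the vertex orders. The monotone tight path $P_r^{(k)}$ is the ordered $k$-uniform hypergraph with vertex set $[r]=\{1,\dots,r\}$ (usual order) whose edges are all sets of $k$ consecutive vertices; for $k=2$ it is the monotone path with $r$ vertices and $r-1$ edges. The on-line Ramsey game with $t$ colors for a target ordered hypergraph $G$: on a large (unbounded) linearly ordered vertex supply, in each round Builder presents a new $k$-set (an edge), and Painter must immediately color it with one of $t$ colors; Builder wins when the colored edges contain a monochromatic copy of $G$ (in the ordered sense). The $t$-color on-line size Ramsey number $\tilde R_t(G)$ is the minimum number of rounds Builder needs to guarantee a win against any Painter strategy. -}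

module Defs where

open import Data.Nat using (ℕ; zero; suc; _<_; _≤_; _*_; _^_; _∸_)
open import Data.Fin using (Fin; inject₁) renaming (suc to fsuc)
open import Data.Product using (_×_; _,_; Σ; ∃)
open import Data.List using (List; []; _∷_)
open import Data.List.Membership.Propositional using (_∈_)
open import Data.List.Relation.Unary.Any using (Any)
open import Relation.Nullary using (¬_)
open import Relation.Binary.PropositionalEquality using (_≡_)

-- Vertex supply: ℕ with its usual order. An (ordered, 2-uniform) edge {i,j}
-- with i < j is represented by the pair (i , j).
Edge : Set
Edge = ℕ × ℕ

CEdge : ℕ → Set
CEdge t = Edge × Fin t

Board : ℕ → Set
Board t = List (CEdge t)

Presented : ∀ {t} → Edge → Board t → Set
Presented e B = Any (λ ce → Data.Product.proj₁ ce ≡ e) B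

MonoPathOfColour : ∀ {t} → (m : ℕ) → Fin t → Board t → Set
MonoPathOfColour m c B =
  Σ (Fin (suc m) → ℕ) λ v →
    (i : Fin m) → (v (inject₁ i) < v (fsuc i)) × (((v (inject₁ i) , v (fsuc i)) , c) ∈ B)

HasMonoPath : ∀ {t} → ℕ → Board t → Set
HasMonoPath {t} m B = ∃ λ (c : Fin t) → MonoPathOfColour m c B

-- BuilderWinsIn t m n B : from board B, Builder can force a monochromatic
-- monotone path with m edges (r = m+1 vertices) within at most n further
-- rounds, whatever Painter does (t colours).
data BuilderWinsIn (t m : ℕ) : ℕ → Board t → Set where
  won  : ∀ {n B} → HasMonoPath m B → BuilderWinsIn t m n B
  move : ∀ {n B} (i j : ℕ) → i < j → ¬ Presented (i , j) B →
         ((c : Fin t) → BuilderWinsIn t m n (((i , j) , c) ∷ B)) →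
         BuilderWinsIn t m (suc n) B

IsOnlineRamseyPath : (t m R : ℕ) → Set
IsOnlineRamseyPath t m R =
  BuilderWinsIn t m R [] × ((n : ℕ) → BuilderWinsIn t m n [] → R ≤ n)

{-# OPTIONS --safe #-}

-- Painter labels the vertices, as they are first touched, with distinct points of a layer
-- (equal coordinate sums) of the grid {0,…,m-1}^t.  Two such points are incomparable, so each
-- edge can receive a colour in which the label increases, and no path reaches m edges while
-- labels last; hence the size of a layer is at most 2R.  The coordinate sums have variance
-- t(m²-1)/12, which forces some layer to have at least m^t / ⌈m√t⌉ points.
--
-- Builder treats the vertices from right to left, recording for each one a vector of lengths of
-- monochromatic paths starting there.  While the current vertex has the same vector as a later
-- one, Builder joins the two; this raises a coordinate, so it happens at most t(m-1) times per
-- vertex.  Distinct vectors run out after m^t vertices.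
--
-- For the minimum R to exist constructively, the game must be decidable: n rounds can be played
-- on 4^n vertices, because inserting a vertex only needs to halve a gap.
module Submission where

open import Defs
open import Data.Nat using (ℕ; zero; suc; _+_; _≤_; _<_; _*_; _^_; _∸_; z≤n; s≤s; _≟_; _≤?_; _<?_; >-nonZero)
open import Data.Nat.Properties
open import Data.Nat.Tactic.RingSolver using (solve-∀)
open import Data.Integer using (ℤ; +_; 0ℤ; 1ℤ)
import Data.Integer as ℤ
import Data.Integer.Properties as ℤ
import Data.Integer.Tactic.RingSolver as ℤ-Solver
open import Data.Fin using (Fin; inject₁) renaming (zero to fzero; suc to fsuc)
import Data.Fin.Properties as Fin
open import Data.Product using (_×_; _,_; ∃; ∃₂; proj₁; proj₂)
open import Data.Product.Properties using (≡-dec)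
open import Data.Sum using (_⊎_; inj₁; inj₂)
import Data.Sum as Sum
open import Data.List using (List; []; _∷_; _++_; length; map; upTo; cartesianProductWith; filter)
import Data.List as List
open import Data.List.Properties using (map-cong-local; length-++; length-map; length-upTo; upTo-∷ʳ)
open import Data.List.Membership.Propositional using (_∈_; _∉_; find; lose)
open import Data.List.Membership.Propositional.Properties
open import Data.List.Membership.DecPropositional _≟_ using (_∈?_)
open import Data.List.Relation.Unary.Any using (Any; here; there; any?; index)
import Data.List.Relation.Unary.Any as Any
import Data.List.Relation.Unary.Any.Properties as Any
open import Data.List.Relation.Unary.All using (All; []; _∷_)
import Data.List.Relation.Unary.All as All
import Data.List.Relation.Unary.All.Properties as All
open import Data.List.Relation.Unary.Unique.Propositional using (Unique; []; _∷_)
import Data.List.Relation.Unary.Unique.Propositional.Properties as Unique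
open import Data.List.Relation.Binary.Subset.Propositional using (_⊆_)
open import Data.Vec using (Vec; []; _∷_; lookup; sum; replicate; _[_]%=_)
import Data.Vec.Properties as Vec
open import Function using (_∘_; id)
open import Relation.Nullary using (¬_; Dec; yes; no; contradiction)
open import Relation.Nullary.Decidable using (map′; _×-dec_; ¬?)
open import Relation.Unary using (Decidable)
open import Relation.Binary.Definitions using (tri<; tri≈; tri>)
open import Relation.Binary.PropositionalEquality using (_≡_; _≢_; refl; sym; trans; cong; cong₂; subst; subst₂; module ≡-Reasoning)

-- The search runs upwards from 0 and the given witness bounds it. It supplies both the Ramsey
-- number itself and an integer square root.
least : {P : ℕ → Set} → Decidable P → ∀ {n} → P n → ∃ λ k → P k × (∀ l → P l → k ≤ l)
least P? {n} Pn with P? 0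
... | yes P0 = 0 , P0 , λ _ _ → z≤n
least P? {zero}  Pn | no ¬P0 = contradiction Pn ¬P0
least P? {suc n} Pn | no ¬P0 with least (P? ∘ suc) {n} Pn
... | k , Pk , minimal = suc k , Pk , λ
  { zero P0 → contradiction P0 ¬P0
  ; (suc l) Pl → s≤s (minimal l Pl) }

-- Monochromatic monotone paths

-- Paths indexed by their number of edges and their first vertex. This suits Builder, who always
-- prepends an edge.
data Chain {t} (B : Board t) (c : Fin t) : ℕ → ℕ → Set where
  stop : ∀ {u} → Chain B c 0 u
  step : ∀ {k u v} → u < v → ((u , v) , c) ∈ B → Chain B c k v → Chain B c (suc k) u

module _ {t} {B : Board t} {c : Fin t} where

  vertex : ∀ {k u} → Chain B c k u → Fin (suc k) → ℕ
  vertex {u = u} _ fzero = u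
  vertex (step _ _ p) (fsuc i) = vertex p i

  vertex-step : ∀ {k u} (p : Chain B c k u) (i : Fin k) →
    vertex p (inject₁ i) < vertex p (fsuc i) × ((vertex p (inject₁ i) , vertex p (fsuc i)) , c) ∈ B
  vertex-step (step u<v e _) fzero    = u<v , e
  vertex-step (step _ _ p)   (fsuc i) = vertex-step p i

  chain⇒path : ∀ {k u} → Chain B c k u → MonoPathOfColour k c B
  chain⇒path p = vertex p , vertex-step p

  path⇒chain : ∀ {k} ((v , _) : MonoPathOfColour k c B) → Chain B c k (v fzero)
  path⇒chain {zero}  _       = stop
  path⇒chain {suc k} (v , s) =
    step (proj₁ (s fzero)) (proj₂ (s fzero)) (path⇒chain (v ∘ fsuc , s ∘ fsuc))

chain-⊆ : ∀ {t} {B B′ : Board t} {c k u} → B ⊆ B′ → Chain B c k u → Chain B′ c k u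
chain-⊆ B⊆B′ stop           = stop
chain-⊆ B⊆B′ (step u<v e p) = step u<v (B⊆B′ e) (chain-⊆ B⊆B′ p)

module _ {t} (B : Board t) (c : Fin t) where

  -- The vertices range over all of ℕ, but only the finitely many edges on the board need
  -- inspection.
  edge-any? : {P : ℕ → ℕ → Set} → (∀ u v → Dec (P u v)) →
    Dec (∃₂ λ u v → ((u , v) , c) ∈ B × P u v)
  edge-any? {P} P? = map′ found (λ (u , v , e , Puv) → lose e (refl , Puv))
    (any? (λ ((u , v) , d) → (d Fin.≟ c) ×-dec P? u v) B)
    where
    found : Any (λ ((u , v) , d) → d ≡ c × P u v) B → ∃₂ λ u v → ((u , v) , c) ∈ B × P u v
    found a with find a
    ... | ((u , v) , _) , e , refl , Puv = u , v , e , Puv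

  chain? : ∀ k u → Dec (Chain B c k u)
  chain? zero    u = yes stop
  chain? (suc k) u = map′
    (λ { (_ , _ , e , refl , u<v , p) → step u<v e p })
    (λ { (step u<v e p) → _ , _ , e , refl , u<v , p })
    (edge-any? (λ u′ v → (u′ ≟ u) ×-dec ((u′ <? v) ×-dec chain? k v)))

  path? : ∀ k → Dec (MonoPathOfColour k c B)
  path? zero    = yes ((λ _ → 0) , λ ())
  path? (suc k) = map′
    (λ (_ , _ , e , u<v , p) → chain⇒path (step u<v e p))
    (λ p → case-step (path⇒chain p))
    (edge-any? (λ u v → (u <? v) ×-dec chain? k v))
    where
    case-step : ∀ {u} → Chain B c (suc k) u → ∃₂ λ u v → ((u , v) , c) ∈ B × u < v × Chain B c k v
    case-step (step u<v e p) = _ , _ , e , u<v , p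

hasMonoPath? : ∀ {t} m (B : Board t) → Dec (HasMonoPath m B)
hasMonoPath? m B = Fin.any? (λ c → path? B c m)

-- Deciding who wins

-- The same game on the vertices below `V`: each round now offers finitely many moves, so a search
-- finds out whether Builder wins.
data WinsBelow (V t m : ℕ) : ℕ → Board t → Set where
  won  : ∀ {n B} → HasMonoPath m B → WinsBelow V t m n B
  move : ∀ {n B} i j → i < j → j < V → ¬ Presented (i , j) B →
         (∀ c → WinsBelow V t m n (((i , j) , c) ∷ B)) → WinsBelow V t m (suc n) B

module _ {V t m : ℕ} where

  winsBelow⇒wins : ∀ {n B} → WinsBelow V t m n B → BuilderWinsIn t m n B
  winsBelow⇒wins (won p)               = won p
  winsBelow⇒wins (move i j i<j _ ¬e w) = move i j i<j ¬e (winsBelow⇒wins ∘ w)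

  presented? : ∀ e (B : Board t) → Dec (Presented e B)
  presented? e = any? (λ ce → ≡-dec _≟_ _≟_ (proj₁ ce) e)

  winsBelow? : ∀ n B → Dec (WinsBelow V t m n B)
  winsBelow? n B with hasMonoPath? m B
  ... | yes p = yes (won p)
  winsBelow? zero    B | no ¬p = no λ { (won p) → ¬p p }
  winsBelow? (suc n) B | no ¬p = map′
    (λ (j , j<V , i , i<j , ¬e , w) → move i j i<j j<V ¬e w)
    (λ { (won p) → contradiction p ¬p
       ; (move i j i<j j<V ¬e w) → j , j<V , i , i<j , ¬e , w })
    (anyUpTo? (λ j → anyUpTo? (λ i →
      ¬? (presented? (i , j) B) ×-dec Fin.all? (λ c → winsBelow? n (((i , j) , c) ∷ B))) j) V)

-- Compressing a play into a bounded vertex set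

relabelEdge : ∀ {t} → (ℕ → ℕ) → CEdge t → CEdge t
relabelEdge φ ((i , j) , c) = (φ i , φ j) , c

relabel : ∀ {t} → (ℕ → ℕ) → Board t → Board t
relabel φ = map (relabelEdge φ)

Supported : ∀ {t} → List ℕ → Board t → Set
Supported U = All (λ ((i , j) , _) → i ∈ U × j ∈ U)

-- The ends 0 and `V` count as neighbours of the outermost images, so that a new extreme vertex
-- finds space too; `room` is the same condition for empty `U`.
record Spread (V g : ℕ) (U : List ℕ) (φ : ℕ → ℕ) : Set where
  field
    room : g ≤ V
    low  : ∀ {u} → u ∈ U → g ≤ φ u
    high : ∀ {u} → u ∈ U → φ u + g ≤ V
    gap  : ∀ {u v} → u ∈ U → v ∈ U → u < v → φ u + g ≤ φ v

shrink : ∀ {V g g′ U φ} → g′ ≤ g → Spread V g U φ → Spread V g′ U φ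
shrink {φ = φ} g′≤g s = record
  { room = ≤-trans g′≤g room
  ; low  = ≤-trans g′≤g ∘ low
  ; high = λ {u} u∈U → ≤-trans (+-monoʳ-≤ (φ u) g′≤g) (high u∈U)
  ; gap  = λ {u} u∈U v∈U u<v → ≤-trans (+-monoʳ-≤ (φ u) g′≤g) (gap u∈U v∈U u<v) }
  where open Spread s

-- The end 0 replaces a missing predecessor. The origin of `p` is remembered because the free space
-- above `p` comes from different fields of `Spread` in the two cases.
predecessor : ∀ (φ : ℕ → ℕ) x U → ∃ λ p →
  (p ≡ 0 ⊎ ∃ λ u → u ∈ U × u < x × p ≡ φ u) × (∀ {u} → u ∈ U → u < x → φ u ≤ p)
predecessor φ x [] = 0 , inj₁ refl , λ ()
predecessor φ x (u ∷ U) with predecessor φ x U | u <? x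
... | p , o , ub | no u≮x = p , Sum.map₂ (λ (v , v∈U , r) → v , there v∈U , r) o , λ
  { (here refl) u<x → contradiction u<x u≮x ; (there v∈U) → ub v∈U }
... | p , o , ub | yes u<x with ≤-total p (φ u)
...   | inj₁ p≤φu = φ u , inj₂ (u , here refl , u<x , refl) , λ
  { (here refl) _ → ≤-refl ; (there v∈U) v<x → ≤-trans (ub v∈U v<x) p≤φu }
...   | inj₂ φu≤p = p , Sum.map₂ (λ (v , v∈U , r) → v , there v∈U , r) o , λ { (here refl) _ → φu≤p ; (there v∈U) → ub v∈U }

update : (ℕ → ℕ) → ℕ → ℕ → ℕ → ℕ
update φ x y u with u ≟ x
... | yes _ = y
... | no  _ = φ u

update-new : ∀ φ x y → update φ x y x ≡ y
update-new φ x y with x ≟ x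
... | yes _  = refl
... | no x≢x = contradiction refl x≢x

update-old : ∀ φ x y {u} → u ≢ x → update φ x y u ≡ φ u
update-old φ x y {u} u≢x with u ≟ x
... | yes u≡x = contradiction u≡x u≢x
... | no _    = refl

2*-split : ∀ p g → p + 2 * g ≡ p + g + g
2*-split = solve-∀

-- A new vertex is sent to the middle of the gap above its predecessor, which halves the gaps.
insert : ∀ {V g U φ} → Spread V (2 * g) U φ → ∀ x → ∃₂ λ U′ φ′ →
  Spread V g U′ φ′ × x ∈ U′ × U ⊆ U′ × (∀ {u} → u ∈ U → φ′ u ≡ φ u)
insert {V} {g} {U} {φ} s x with x ∈? U
... | yes x∈U = U , φ , shrink (m≤m+n g _) s , x∈U , id , λ _ → refl
... | no  x∉U with predecessor φ x U
...   | p , p-origin , p-max = x ∷ U , φ′ , spread , here refl , there , old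
  where
  open Spread s
  φ′ = update φ x (p + g)

  new : φ′ x ≡ p + g
  new = update-new φ x (p + g)

  old : ∀ {u} → u ∈ U → φ′ u ≡ φ u
  old u∈U = update-old φ x (p + g) λ { refl → x∉U u∈U }

  Origin = p ≡ 0 ⊎ ∃ λ u → u ∈ U × u < x × p ≡ φ u

  fits : Origin → p + 2 * g ≤ V
  fits (inj₁ refl)                 = room
  fits (inj₂ (_ , u∈U , _ , refl)) = high u∈U

  below : Origin → ∀ {v} → v ∈ U → x < v → p + 2 * g ≤ φ v
  below (inj₁ refl)                   v∈U x<v = low v∈U
  below (inj₂ (_ , u∈U , u<x , refl)) v∈U x<v = gap u∈U v∈U (<-trans u<x x<v)

  low′ : ∀ {u} → u ∈ x ∷ U → g ≤ φ′ u
  low′ (here refl) rewrite new = m≤n+m g p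
  low′ (there u∈U) rewrite old u∈U = Spread.low (shrink (m≤m+n g _) s) u∈U

  high′ : ∀ {u} → u ∈ x ∷ U → φ′ u + g ≤ V
  high′ (here refl) rewrite new = subst (_≤ V) (2*-split p g) (fits p-origin)
  high′ (there u∈U) rewrite old u∈U = Spread.high (shrink (m≤m+n g _) s) u∈U

  gap′ : ∀ {u v} → u ∈ x ∷ U → v ∈ x ∷ U → u < v → φ′ u + g ≤ φ′ v
  gap′ (here refl) (here refl) x<x = contradiction x<x (<-irrefl refl)
  gap′ {v = v} (here refl) (there v∈U) x<v rewrite new | old v∈U =
    subst (_≤ φ v) (2*-split p g) (below p-origin v∈U x<v)
  gap′ (there u∈U) (here refl) u<x rewrite new | old u∈U = +-monoˡ-≤ g (p-max u∈U u<x)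
  gap′ (there u∈U) (there v∈U) u<v rewrite old u∈U | old v∈U =
    Spread.gap (shrink (m≤m+n g _) s) u∈U v∈U u<v

  spread : Spread V g (x ∷ U) φ′
  spread = record { room = ≤-trans (m≤m+n g _) room ; low = low′ ; high = high′ ; gap = gap′ }

module _ {V g U φ} (s : Spread V (suc g) U φ) where
  open Spread s

  spread-mono : ∀ {u v} → u ∈ U → v ∈ U → u < v → φ u < φ v
  spread-mono {u} u∈U v∈U u<v = <-≤-trans (m<m+n (φ u) (s≤s z≤n)) (gap u∈U v∈U u<v)

  spread-< : ∀ {u} → u ∈ U → φ u < V
  spread-< {u} u∈U = <-≤-trans (m<m+n (φ u) (s≤s z≤n)) (high u∈U)

  spread-injective : ∀ {u v} → u ∈ U → v ∈ U → φ u ≡ φ v → u ≡ v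
  spread-injective {u} {v} u∈U v∈U eq with <-cmp u v
  ... | tri< u<v _ _ = contradiction eq (<⇒≢ (spread-mono u∈U v∈U u<v))
  ... | tri≈ _ u≡v _ = u≡v
  ... | tri> _ _ v<u = contradiction (sym eq) (<⇒≢ (spread-mono v∈U u∈U v<u))

relabel-presented : ∀ {t V g U φ} {B : Board t} → Spread V (suc g) U φ → Supported U B →
  ∀ {i j} → i ∈ U → j ∈ U → Presented (φ i , φ j) (relabel φ B) → Presented (i , j) B
relabel-presented s ((k∈U , l∈U) ∷ _) i∈U j∈U (here eq) = here (cong₂ _,_
  (spread-injective s k∈U i∈U (cong proj₁ eq)) (spread-injective s l∈U j∈U (cong proj₂ eq)))
relabel-presented s (_ ∷ supp) i∈U j∈U (there e) = there (relabel-presented s supp i∈U j∈U e)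

relabel-path : ∀ {t V g U φ m} {B : Board t} → Spread V (suc g) U φ → Supported U B →
  HasMonoPath m B → HasMonoPath m (relabel φ B)
relabel-path {φ = φ} s supp (c , v , steps) = c , φ ∘ v , λ i →
  let v<v′ , e = steps i
      u∈U , u′∈U = All.lookup supp e
  in spread-mono s u∈U u′∈U v<v′ , ∈-map⁺ (relabelEdge φ) e

module _ {V t m : ℕ} where

  -- Builder's strategy is followed move by move. A round inserts two endpoints, each halving the
  -- gap, which costs a factor 4. Old vertices keep their images, so the relabelled board stays as
  -- it was.
  compress : ∀ n {B U φ} → Spread V (4 ^ n) U φ → Supported U B →
    BuilderWinsIn t m n B → WinsBelow V t m n (relabel φ B)
  compress n s supp (won p) = won (relabel-path (shrink (m^n>0 4 n) s) supp p)
  compress (suc n) {B} {U} {φ} s supp (move i j i<j ¬e w)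
    with insert (subst (λ g → Spread V g U φ) (*-assoc 2 2 (4 ^ n)) s) i
  ... | U₁ , φ₁ , s₁ , i∈U₁ , U⊆U₁ , φ₁≗φ with insert s₁ j
  ... | U₂ , φ₂ , s₂ , j∈U₂ , U₁⊆U₂ , φ₂≗φ₁ =
    subst (WinsBelow V t m (suc n)) same
      (move (φ₂ i) (φ₂ j) (spread-mono s₃ i∈U₂ j∈U₂ i<j) (spread-< s₃ j∈U₂)
        (¬e ∘ relabel-presented s₃ supp₂ i∈U₂ j∈U₂)
        (λ c → compress n s₂ ((i∈U₂ , j∈U₂) ∷ supp₂) (w c)))
    where
    i∈U₂ = U₁⊆U₂ i∈U₁
    s₃ = shrink (m^n>0 4 n) s₂
    supp₂ : Supported U₂ B
    supp₂ = All.map (λ (k∈U , l∈U) → U₁⊆U₂ (U⊆U₁ k∈U) , U₁⊆U₂ (U⊆U₁ l∈U)) supp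
    agree : ∀ {u} → u ∈ U → φ₂ u ≡ φ u
    agree u∈U = trans (φ₂≗φ₁ (U⊆U₁ u∈U)) (φ₁≗φ u∈U)
    same : relabel φ₂ B ≡ relabel φ B
    same = map-cong-local (All.map (λ (k∈U , l∈U) → cong₂ (λ a b → (a , b) , _) (agree k∈U) (agree l∈U)) supp)

builderWins? : ∀ t m n → Dec (BuilderWinsIn t m n [])
builderWins? t m n = map′ winsBelow⇒wins
  (compress n {U = []} {φ = id}
    (record { room = ≤-refl ; low = λ () ; high = λ () ; gap = λ () }) [])
  (winsBelow? {4 ^ n} n [])

-- The grid

grid : ℕ → ∀ t → List (Vec ℕ t)
grid m zero    = [] ∷ []
grid m (suc t) = cartesianProductWith _∷_ (upTo m) (grid m t)

Bounded : ∀ {t} → ℕ → Vec ℕ t → Set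
Bounded m x = ∀ c → lookup x c < m

bounded⇒∈grid : ∀ {m t} (x : Vec ℕ t) → Bounded m x → x ∈ grid m t
bounded⇒∈grid []      _  = here refl
bounded⇒∈grid (a ∷ x) bd = ∈-cartesianProductWith⁺ _∷_ (∈-upTo⁺ (bd fzero)) (bounded⇒∈grid x (bd ∘ fsuc))

∈grid⇒bounded : ∀ {m t} {x : Vec ℕ t} → x ∈ grid m t → Bounded m x
∈grid⇒bounded {m} {suc t} x∈ with ∈-cartesianProductWith⁻ _∷_ (upTo m) (grid m t) x∈
... | a , y , a∈ , y∈ , refl = λ { fzero → ∈-upTo⁻ a∈ ; (fsuc c) → ∈grid⇒bounded y∈ c }

grid-unique : ∀ m t → Unique (grid m t)
grid-unique m zero    = [] ∷ []
grid-unique m (suc t) = Unique.cartesianProductWith⁺ _∷_ Vec.∷-injective (Unique.upTo⁺ m) (grid-unique m t)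

length-cartesianProductWith : ∀ {A B C : Set} (f : A → B → C) xs ys →
  length (cartesianProductWith f xs ys) ≡ length xs * length ys
length-cartesianProductWith f []       ys = refl
length-cartesianProductWith f (x ∷ xs) ys = trans (length-++ (map (f x) ys))
  (cong₂ _+_ (length-map (f x) ys) (length-cartesianProductWith f xs ys))

length-grid : ∀ m t → length (grid m t) ≡ m ^ t
length-grid m zero    = refl
length-grid m (suc t) = trans (length-cartesianProductWith _∷_ (upTo m) (grid m t))
  (cong₂ _*_ (length-upTo m) (length-grid m t))

unique⇒lookup-injective : ∀ {A : Set} {xs : List A} → Unique xs → ∀ {i j} →
  List.lookup xs i ≡ List.lookup xs j → i ≡ j
unique⇒lookup-injective (_ ∷ _) {fzero} {fzero} _ = refl
unique⇒lookup-injective (x≢ ∷ _) {fzero} {fsuc j} eq = contradiction eq (All.lookup x≢ (∈-lookup j))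
unique⇒lookup-injective (x≢ ∷ _) {fsuc i} {fzero} eq = contradiction (sym eq) (All.lookup x≢ (∈-lookup i))
unique⇒lookup-injective (_ ∷ un) {fsuc i} {fsuc j} eq = cong fsuc (unique⇒lookup-injective un eq)

-- Pigeonhole: each position of `xs` goes to a position of `ys` with the same entry, and since `xs`
-- has no repetitions this map is injective.
unique-⊆⇒length≤ : ∀ {A : Set} {xs ys : List A} → Unique xs → xs ⊆ ys → length xs ≤ length ys
unique-⊆⇒length≤ {xs = xs} {ys} un xs⊆ys = Fin.injective⇒≤ {f = f} λ {i} {j} eq →
  unique⇒lookup-injective un (trans (Any.lookup-index (mem i)) (trans (cong (List.lookup ys) eq) (sym (Any.lookup-index (mem j)))))
  where
  mem : ∀ i → List.lookup xs i ∈ ys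
  mem i = xs⊆ys (∈-lookup i)
  f : Fin (length xs) → Fin (length ys)
  f i = index (mem i)

-- Vectors ordered coordinatewise

dominated-sum : ∀ {t} (x y : Vec ℕ t) → (∀ c → lookup y c ≤ lookup x c) → sum y ≤ sum x
dominated-sum []      []      _   = z≤n
dominated-sum (a ∷ x) (b ∷ y) y≤x = +-mono-≤ (y≤x fzero) (dominated-sum x y (y≤x ∘ fsuc))

-- Neither the head nor the tail of `y` can fall short, since the other part cannot make up for the
-- loss.
dominated-equal-sum : ∀ {t} (x y : Vec ℕ t) → (∀ c → lookup y c ≤ lookup x c) → sum x ≤ sum y → x ≡ y
dominated-equal-sum []      []      _   _ = refl
dominated-equal-sum (a ∷ x) (b ∷ y) y≤x s =
  cong₂ _∷_ (≤-antisym a≤b (y≤x fzero)) (dominated-equal-sum x y (y≤x ∘ fsuc) x≤y)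
  where
  a≤b : a ≤ b
  a≤b = +-cancelʳ-≤ (sum y) a b (≤-trans (+-monoʳ-≤ a (dominated-sum x y (y≤x ∘ fsuc))) s)
  x≤y : sum x ≤ sum y
  x≤y = +-cancelˡ-≤ b (sum x) (sum y) (≤-trans (+-monoˡ-≤ (sum x) (y≤x fzero)) s)

-- A layer is an antichain: without such a coordinate `y` would lie below `x` everywhere, and equal
-- sums would force equality.
equal-sum⇒incomparable : ∀ {t} {x y : Vec ℕ t} → sum x ≡ sum y → x ≢ y → ∃ λ c → lookup x c < lookup y c
equal-sum⇒incomparable {x = x} {y} s x≢y with Fin.any? (λ c → lookup x c <? lookup y c)
... | yes c = c
... | no ¬c = contradiction (dominated-equal-sum x y (λ c → ≮⇒≥ (λ lt → ¬c (c , lt))) (≤-reflexive s)) x≢y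

sum-bounded : ∀ {t m} (x : Vec ℕ t) → Bounded (suc m) x → sum x ≤ t * m
sum-bounded []      _  = z≤n
sum-bounded (a ∷ x) bd = +-mono-≤ (≤-pred (bd fzero)) (sum-bounded x (bd ∘ fsuc))

sum-increment : ∀ {t} (x : Vec ℕ t) c → sum (x [ c ]%= suc) ≡ suc (sum x)
sum-increment (a ∷ x) fzero    = refl
sum-increment (a ∷ x) (fsuc c) = trans (cong (_+_ a) (sum-increment x c)) (+-suc a (sum x))

-- Painter's strategy

-- The list has the latest vertex in front, and the label counts the entries behind a vertex. Hence
-- later additions do not change it. The value 0 for an absent vertex is a default.
label : ℕ → List ℕ → ℕ
label v []       = 0
label v (u ∷ us) with v ≟ u
... | yes _ = length us
... | no  _ = label v us

label-old : ∀ {u v us} → v ≢ u → label v (u ∷ us) ≡ label v us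
label-old {u} {v} v≢u with v ≟ u
... | yes v≡u = contradiction v≡u v≢u
... | no _    = refl

label-< : ∀ {v us} → v ∈ us → label v us < length us
label-< {v} {u ∷ us} v∈ with v ≟ u | v∈
... | yes _  | _         = ≤-refl
... | no v≢u | here v≡u  = contradiction v≡u v≢u
... | no _   | there v∈′ = m≤n⇒m≤1+n (label-< v∈′)

label-injective : ∀ {v w us} → v ∈ us → w ∈ us → label v us ≡ label w us → v ≡ w
label-injective {v} {w} {u ∷ us} v∈ w∈ eq with v ≟ u | w ≟ u | v∈ | w∈
... | yes refl | yes refl | _ | _ = refl
... | yes _ | no w≢u | _ | here w≡u = contradiction w≡u w≢u
... | yes _ | no _ | _ | there w∈′ = contradiction (sym eq) (<⇒≢ (label-< w∈′))
... | no v≢u | _ | here v≡u | _ = contradiction v≡u v≢u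
... | no _ | yes _ | there v∈′ | _ = contradiction eq (<⇒≢ (label-< v∈′))
... | no _ | no w≢u | there _ | here w≡u = contradiction w≡u w≢u
... | no _ | no _ | there v∈′ | there w∈′ = label-injective v∈′ w∈′ eq

enlist : ∀ v us → ∃ λ us′ → length us′ ≤ suc (length us) × v ∈ us′ ×
  (∀ {u} → u ∈ us → u ∈ us′ × label u us′ ≡ label u us)
enlist v us with v ∈? us
... | yes v∈us = us , n≤1+n _ , v∈us , λ u∈us → u∈us , refl
... | no  v∉us = v ∷ us , ≤-refl , here refl , λ u∈us → there u∈us , label-old {us = us} λ { refl → v∉us u∈us }

-- `g k` is the vector given to the vertex with label `k`. Separation is asked for in both
-- directions because vertices may be touched in an order unrelated to their order in ℕ.
module Painter {t m N : ℕ} (g : ℕ → Vec ℕ t)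
  (g-bounded : ∀ {k} → k < N → Bounded (suc m) (g k))
  (g-separated : ∀ {k l} → k < N → l < N → k ≢ l → ∃ λ c → lookup (g k) c < lookup (g l) c) where

  level : List ℕ → ℕ → Fin t → ℕ
  level us v c = lookup (g (label v us)) c

  Consistent : List ℕ → Board t → Set
  Consistent us B = ∀ {i j c} → ((i , j) , c) ∈ B → i ∈ us × j ∈ us × level us i c < level us j c

  -- Every edge of colour `c` raises coordinate `c`, which never exceeds `m`. At least one edge is
  -- assumed so that the last vertex is known to be listed and thus to have a bounded level.
  chain-level : ∀ {us B c k u} → length us ≤ N → Consistent us B → Chain B c (suc k) u →
    suc k + level us u c ≤ m
  chain-level {us} {c = c} {u = u} us≤N con (step {v = v} _ e stop) with con e
  ... | _ , v∈us , lt = ≤-trans lt (≤-pred (g-bounded (<-≤-trans (label-< v∈us) us≤N) c))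
  chain-level {us} {c = c} {k = suc k} {u = u} us≤N con (step {v = v} _ e p@(step _ _ _)) with con e
  ... | _ , _ , lt = begin
    suc (suc k) + level us u c ≡⟨ +-suc (suc k) (level us u c) ⟨
    suc k + suc (level us u c) ≤⟨ +-monoʳ-≤ (suc k) lt ⟩
    suc k + level us v c       ≤⟨ chain-level us≤N con p ⟩
    m ∎
    where open ≤-Reasoning

  -- A round touches at most two new vertices, so `2 * n` spare labels suffice for `n` rounds.
  -- Painter answers with a coordinate that increases from `i` to `j`, which keeps the board
  -- consistent, and a consistent board has no path with `m + 1` edges.
  survives : ∀ n {us B} → 2 * n + length us ≤ N → Consistent us B → ¬ BuilderWinsIn t (suc m) n B
  survives n fits con (won (c , path)) =
    <-irrefl refl (m+n≤o⇒m≤o (suc m) (chain-level (m+n≤o⇒n≤o (2 * n) fits) con (path⇒chain path)))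
  survives (suc n) {us} {B} fits con (move i j i<j _ w) with enlist i us
  ... | us₁ , len₁ , i∈₁ , old₁ with enlist j us₁
  ... | us₂ , len₂ , j∈₂ , old₂ = survives n fits₂ con₂ (w c)
    where
    i∈₂ = proj₁ (old₂ i∈₁)

    fits₂ : 2 * n + length us₂ ≤ N
    fits₂ = begin
      2 * n + length us₂             ≤⟨ +-monoʳ-≤ (2 * n) (≤-trans len₂ (s≤s len₁)) ⟩
      2 * n + suc (suc (length us))  ≡⟨ shift n (length us) ⟩
      2 * suc n + length us          ≤⟨ fits ⟩
      N ∎
      where
      open ≤-Reasoning
      shift : ∀ n l → 2 * n + suc (suc l) ≡ 2 * suc n + l
      shift = solve-∀

    us₂≤N = m+n≤o⇒n≤o (2 * n) fits₂

    separating : ∃ λ c → level us₂ i c < level us₂ j c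
    separating = g-separated (<-≤-trans (label-< i∈₂) us₂≤N) (<-≤-trans (label-< j∈₂) us₂≤N)
      λ eq → <⇒≢ i<j (label-injective i∈₂ j∈₂ eq)

    c = proj₁ separating

    con₂ : Consistent us₂ (((i , j) , c) ∷ B)
    con₂ (here refl) = i∈₂ , j∈₂ , proj₂ separating
    con₂ (there e) with con e
    ... | k∈ , l∈ , lt with old₁ k∈ | old₁ l∈
    ... | k∈₁ , k₁ | l∈₁ , l₁ with old₂ k∈₁ | old₂ l∈₁
    ... | k∈₂ , k₂ | l∈₂ , l₂ rewrite k₂ | l₂ | k₁ | l₁ = k∈₂ , l∈₂ , lt

-- Indexing made total, because Painter's labelling is a function on all of ℕ; `d` is returned only
-- past the end.
nth : ∀ {A : Set} → A → List A → ℕ → A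
nth d []       _       = d
nth d (x ∷ xs) zero    = x
nth d (x ∷ xs) (suc k) = nth d xs k

module _ {A : Set} (d : A) where

  nth-∈ : ∀ {xs k} → k < length xs → nth d xs k ∈ xs
  nth-∈ {x ∷ xs} {zero}  _         = here refl
  nth-∈ {x ∷ xs} {suc k} (s≤s k<n) = there (nth-∈ k<n)

  nth-injective : ∀ {xs k l} → Unique xs → k < length xs → l < length xs → nth d xs k ≡ nth d xs l → k ≡ l
  nth-injective {_ ∷ _} {zero}  {zero}  _ _ _ _ = refl
  nth-injective {_ ∷ _} {zero}  {suc l} (x≢ ∷ _) _ (s≤s l<) eq = contradiction eq (All.lookup x≢ (nth-∈ l<))
  nth-injective {_ ∷ _} {suc k} {zero}  (x≢ ∷ _) (s≤s k<) _ eq = contradiction (sym eq) (All.lookup x≢ (nth-∈ k<))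
  nth-injective {_ ∷ _} {suc k} {suc l} (_ ∷ un) (s≤s k<) (s≤s l<) eq = cong suc (nth-injective un k< l< eq)

-- With more than `2 * n` points of one layer, Painter could give each touched vertex its own point
-- and survive `n` rounds.
antichain-bound : ∀ {t m s n} (xs : List (Vec ℕ t)) → Unique xs → (∀ {x} → x ∈ xs → Bounded (suc m) x × sum x ≡ s) →
  BuilderWinsIn t (suc m) n [] → length xs ≤ 2 * n
antichain-bound {t} {m} {s} {n} xs un prop w = ≮⇒≥ λ lt →
  survives n {us = []} (subst (_≤ length xs) (sym (+-identityʳ (2 * n))) (<⇒≤ lt)) (λ ()) w
  where
  d = replicate t 0
  open Painter {m = m} (nth d xs) (λ k< → proj₁ (prop (nth-∈ d k<)))
    (λ k< l< k≢l → equal-sum⇒incomparable (trans (proj₂ (prop (nth-∈ d k<))) (sym (proj₂ (prop (nth-∈ d l<)))))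
      (k≢l ∘ nth-injective d un k< l<))

-- Builder's strategy

module Builder (t m : ℕ) where

  ChainsAt : Board t → ℕ → Vec ℕ t → Set
  ChainsAt B v x = ∀ c → Chain B c (lookup x c) v

  -- `D` holds the finished vertices with their vectors, and `v` is the current vertex with vector
  -- `w`. By `played`, an edge from `v` to a finished vertex with the same vector is still
  -- available; `fresh` makes every edge from the vertices left of `v` available.
  record State (B : Board t) (D : List (ℕ × Vec ℕ t)) (v : ℕ) (w : Vec ℕ t) : Set where
    field
      done       : ∀ {u x} → (u , x) ∈ D → v < u × Bounded (suc m) x × ChainsAt B u x
      functional : ∀ {u x y} → (u , x) ∈ D → (u , y) ∈ D → x ≡ y
      distinct   : Unique (map proj₂ D)
      bounded    : Bounded (suc m) w
      chains     : ChainsAt B v w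
      played     : ∀ {u x} → Presented (v , u) B → (u , x) ∈ D → ∃ λ c → lookup x c < lookup w c
      fresh      : ∀ {i j} → Presented (i , j) B → v ≤ i

  start : ∀ v → State [] [] v (replicate t 0)
  start v = record
    { done = λ () ; functional = λ () ; distinct = [] ; played = λ () ; fresh = λ ()
    ; bounded = λ c → subst (_< suc m) (sym (Vec.lookup-replicate c 0)) (s≤s z≤n)
    ; chains = λ c → subst (λ k → Chain [] c k v) (sym (Vec.lookup-replicate c 0)) stop }

  -- The edge from v to a finished vertex u with the same vector raises one coordinate of v.
  respond : ∀ {B D v w u} → State B D v w → (u , w) ∈ D → ∀ c → lookup w c < m →
    State (((v , u) , c) ∷ B) D v (w [ c ]%= suc)
  respond {B} {D} {v} {w} {u} st u∈D c wc<m = record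
    { done = λ x∈D → let v<u , bd , ch = done x∈D in v<u , bd , chain-⊆ there ∘ ch
    ; functional = functional ; distinct = distinct
    ; bounded = bounded′ ; chains = chains′ ; played = played′ ; fresh = fresh′ }
    where
    open State st

    raised : lookup (w [ c ]%= suc) c ≡ suc (lookup w c)
    raised = Vec.lookup∘updateAt c w

    kept : ∀ {d} → d ≢ c → lookup (w [ c ]%= suc) d ≡ lookup w d
    kept {d} d≢c = Vec.lookup∘updateAt′ d c d≢c w

    bounded′ : Bounded (suc m) (w [ c ]%= suc)
    bounded′ d with d Fin.≟ c
    ... | yes refl rewrite raised   = s≤s wc<m
    ... | no d≢c   rewrite kept d≢c = bounded d

    chains′ : ChainsAt (((v , u) , c) ∷ B) v (w [ c ]%= suc)
    chains′ d with d Fin.≟ c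
    ... | yes refl rewrite raised   = step (proj₁ (done u∈D)) (here refl) (chain-⊆ there (proj₂ (proj₂ (done u∈D)) c))
    ... | no d≢c   rewrite kept d≢c = chain-⊆ there (chains d)

    played′ : ∀ {u′ x} → Presented (v , u′) (((v , u) , c) ∷ B) → (u′ , x) ∈ D →
      ∃ λ d → lookup x d < lookup (w [ c ]%= suc) d
    played′ (here refl) x∈D with functional x∈D u∈D
    ... | refl = c , subst (lookup w c <_) (sym raised) ≤-refl
    played′ (there e) x∈D with played e x∈D
    ... | d , lt with d Fin.≟ c
    ... | yes refl = c , subst (_ <_) (sym raised) (m≤n⇒m≤1+n lt)
    ... | no d≢c   = d , subst (_ <_) (sym (kept d≢c)) lt

    fresh′ : ∀ {i j} → Presented (i , j) (((v , u) , c) ∷ B) → v ≤ i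
    fresh′ (here refl) = ≤-refl
    fresh′ (there e)   = fresh e

  advance : ∀ {B D v w} → State B D (suc v) w → w ∉ map proj₂ D →
    State B ((suc v , w) ∷ D) v (replicate t 0)
  advance {B} {D} {v} {w} st w∉ = record
    { done = λ { (here refl) → ≤-refl , bounded , chains
               ; (there x∈D) → let v<u , r = done x∈D in <-trans (n<1+n v) v<u , r }
    ; functional = functional′
    ; distinct = All.¬Any⇒All¬ _ w∉ ∷ distinct
    ; bounded = State.bounded (start v)
    ; chains = chain-⊆ (λ ()) ∘ State.chains (start v)
    ; played = λ e _ → contradiction (fresh e) (<-irrefl refl)
    ; fresh = <⇒≤ ∘ fresh }
    where
    open State st
    functional′ : ∀ {u x y} → (u , x) ∈ (suc v , w) ∷ D → (u , y) ∈ (suc v , w) ∷ D → x ≡ y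
    functional′ (here refl) (here refl) = refl
    functional′ (here refl) (there y∈D) = contradiction (proj₁ (done y∈D)) (<-irrefl refl)
    functional′ (there x∈D) (here refl) = contradiction (proj₁ (done x∈D)) (<-irrefl refl)
    functional′ (there x∈D) (there y∈D) = functional x∈D y∈D

  exhausted : ∀ {B D v w} → State B D v w → w ∉ map proj₂ D → length D < suc m ^ t
  exhausted {D = D} {w = w} st w∉ = begin
    suc (length D)              ≡⟨ cong suc (length-map proj₂ D) ⟨
    length (w ∷ map proj₂ D)    ≤⟨ unique-⊆⇒length≤ (All.¬Any⇒All¬ _ w∉ ∷ distinct) inGrid ⟩
    length (grid (suc m) t)     ≡⟨ length-grid (suc m) t ⟩
    suc m ^ t ∎
    where
    open ≤-Reasoning
    open State st
    inGrid : w ∷ map proj₂ D ⊆ grid (suc m) t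
    inGrid (here refl) = bounded⇒∈grid w bounded
    inGrid (there x∈) with ∈-map⁻ proj₂ x∈
    ... | (_ , x) , x∈D , refl = bounded⇒∈grid x (proj₁ (proj₂ (done x∈D)))

  -- The current vertex still needs at most `t * m` minus `sum w` raising rounds, and each of the
  -- `v` vertices to its left at most `t * m`. The strict inequality reserves one more round for the
  -- winning edge, which raises nothing.
  play : ∀ v n {B D w} → State B D v w → length D + v ≡ suc m ^ t →
    v * (t * m) + t * m < n + sum w → BuilderWinsIn t (suc m) n B
  play v n {B} {D} {w} st len budget with any? (λ (_ , x) → Vec.≡-dec _≟_ x w) D
  play v zero {w = w} st len budget | yes _ = contradiction
    (≤-trans (sum-bounded w (State.bounded st)) (m≤n+m (t * m) (v * (t * m)))) (<⇒≱ budget)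
  play v (suc n) {B} {D} {w} st len budget | yes same with find same
  ... | (u , _) , u∈D , refl = move v u v<u unplayed reply
    where
    open State st
    v<u = proj₁ (done u∈D)

    unplayed : ¬ Presented (v , u) B
    unplayed e = <-irrefl refl (proj₂ (played e u∈D))

    reply : ∀ c → BuilderWinsIn t (suc m) n (((v , u) , c) ∷ B)
    reply c with lookup w c <? m
    ... | yes wc<m = play v n (respond st u∈D c wc<m) len
      (subst (v * (t * m) + t * m <_) (sym (trans (cong (_+_ n) (sum-increment w c)) (+-suc n (sum w)))) budget)
    -- Coordinate `c` is already `m`, so the new edge extends a chain of `m` edges at `u` to one of
    -- `m + 1`.
    ... | no wc≮m = won (c , chain⇒path (step v<u (here refl)
      (subst (λ k → Chain _ c k u) (≤-antisym (≤-pred (bounded c)) (≮⇒≥ wc≮m))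
        (chain-⊆ there (proj₂ (proj₂ (done u∈D)) c)))))
  -- At vertex 0 all points of the grid have been recorded, so no vector can be new.
  play zero n {D = D} st len budget | no new = contradiction
    (trans (sym (+-identityʳ (length D))) len)
    (<⇒≢ (exhausted st λ w∈ → new (Any.map sym (Any.map⁻ w∈))))
  play (suc v) n {D = D} {w} st len budget | no new =
    play v n (advance st λ w∈ → new (Any.map sym (Any.map⁻ w∈)))
      (trans (sym (+-suc (length D) v)) len) (+-cancelʳ-< (sum w) _ _ budget′)
    where
    open ≤-Reasoning
    shuffle : ∀ a b → b + a + b ≡ a + b + b
    shuffle = solve-∀
    budget′ : v * (t * m) + t * m + sum w < n + sum (replicate t 0) + sum w
    budget′ = begin-strict
      v * (t * m) + t * m + sum w       ≤⟨ +-monoʳ-≤ (v * (t * m) + t * m) (sum-bounded w (State.bounded st)) ⟩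
      v * (t * m) + t * m + t * m       ≡⟨ shuffle (v * (t * m)) (t * m) ⟨
      t * m + v * (t * m) + t * m       <⟨ budget ⟩
      n + sum w                         ≤⟨ +-monoˡ-≤ (sum w) (m≤m+n n _) ⟩
      n + sum (replicate t 0) + sum w ∎

  wins : ∀ {n} → suc m ^ t * (t * m) + t * m < n → BuilderWinsIn t (suc m) n []
  wins {n} budget = play (suc m ^ t) n (start _) refl (<-≤-trans budget (m≤m+n n _))

-- There are `M + 1` vertices with at most `T * m` raising rounds each. Replacing the factor `m` by
-- `m + 1` in `M * (T * m)` gains `T * M`, which pays for the extra vertex and for the strict
-- inequality.
builder-bound : ∀ t m → BuilderWinsIn (suc t) (suc m) (suc t * suc m ^ (suc t + 1)) []
builder-bound t m = Builder.wins (suc t) m (begin-strict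
  M * (T * m) + T * m            <⟨ +-monoʳ-< (M * (T * m)) (begin-strict
    T * m <⟨ *-monoʳ-< T (n<1+n m) ⟩
    T * suc m ≡⟨ cong (T *_) (*-identityʳ (suc m)) ⟨
    T * (suc m * 1) ≤⟨ *-monoʳ-≤ T (*-monoʳ-≤ (suc m) (m^n>0 (suc m) t)) ⟩
    T * M ∎) ⟩
  M * (T * m) + T * M            ≡⟨ regroup M T m ⟩
  T * (M * (suc m * 1))          ≡⟨ cong (T *_) (^-distribˡ-+-* (suc m) T 1) ⟨
  T * suc m ^ (T + 1) ∎)
  where
  open ≤-Reasoning
  T = suc t
  M = suc m ^ T
  regroup : ∀ M T m → M * (T * m) + T * M ≡ T * (M * (suc m * 1))
  regroup = solve-∀

-- Integer-valued sums

-- The values are integers because the test weights below may be negative.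
∑ : {A : Set} → (A → ℤ) → List A → ℤ
∑ f []       = 0ℤ
∑ f (x ∷ xs) = f x ℤ.+ ∑ f xs

module _ {A : Set} where

  ∑-cong : {f g : A → ℤ} → (∀ x → f x ≡ g x) → ∀ xs → ∑ f xs ≡ ∑ g xs
  ∑-cong f≗g []       = refl
  ∑-cong f≗g (x ∷ xs) = cong₂ ℤ._+_ (f≗g x) (∑-cong f≗g xs)

  ∑-mono : {f g : A → ℤ} → ∀ xs → (∀ {x} → x ∈ xs → f x ℤ.≤ g x) → ∑ f xs ℤ.≤ ∑ g xs
  ∑-mono []       f≤g = ℤ.≤-refl
  ∑-mono (x ∷ xs) f≤g = ℤ.+-mono-≤ (f≤g (here refl)) (∑-mono xs (f≤g ∘ there))

  ∑-+ : (f g : A → ℤ) → ∀ xs → ∑ (λ x → f x ℤ.+ g x) xs ≡ ∑ f xs ℤ.+ ∑ g xs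
  ∑-+ f g []       = refl
  ∑-+ f g (x ∷ xs) rewrite ∑-+ f g xs = interchange (f x) (g x) (∑ f xs) (∑ g xs)
    where
    interchange : ∀ a b c d → a ℤ.+ b ℤ.+ (c ℤ.+ d) ≡ a ℤ.+ c ℤ.+ (b ℤ.+ d)
    interchange = ℤ-Solver.solve-∀

  ∑-* : ∀ k (f : A → ℤ) xs → ∑ (λ x → k ℤ.* f x) xs ≡ k ℤ.* ∑ f xs
  ∑-* k f []       = sym (ℤ.*-zeroʳ k)
  ∑-* k f (x ∷ xs) rewrite ∑-* k f xs = sym (ℤ.*-distribˡ-+ k (f x) (∑ f xs))

  ∑-const : ∀ k (xs : List A) → ∑ (λ _ → k) xs ≡ + length xs ℤ.* k
  ∑-const k []       = sym (ℤ.*-zeroˡ k)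
  ∑-const k (x ∷ xs) rewrite ∑-const k xs = factor k (+ length xs)
    where
    factor : ∀ k l → k ℤ.+ l ℤ.* k ≡ (1ℤ ℤ.+ l) ℤ.* k
    factor = ℤ-Solver.solve-∀

  ∑-const-minus : ∀ k (f : A → ℤ) xs → ∑ (λ x → k ℤ.- f x) xs ≡ + length xs ℤ.* k ℤ.- ∑ f xs
  ∑-const-minus k f xs = begin
    ∑ (λ x → k ℤ.- f x) xs                          ≡⟨ ∑-cong (λ x → cong (ℤ._+_ k) (ℤ.-1*i≡-i (f x))) xs ⟨
    ∑ (λ x → k ℤ.+ ℤ.-1ℤ ℤ.* f x) xs                ≡⟨ ∑-+ _ _ xs ⟩
    ∑ (λ _ → k) xs ℤ.+ ∑ (λ x → ℤ.-1ℤ ℤ.* f x) xs   ≡⟨ cong₂ ℤ._+_ (∑-const k xs) (trans (∑-* ℤ.-1ℤ f xs) (ℤ.-1*i≡-i _)) ⟩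
    + length xs ℤ.* k ℤ.- ∑ f xs ∎
    where open ≡-Reasoning

  ∑-++ : ∀ (f : A → ℤ) xs ys → ∑ f (xs ++ ys) ≡ ∑ f xs ℤ.+ ∑ f ys
  ∑-++ f []       ys = sym (ℤ.+-identityˡ _)
  ∑-++ f (x ∷ xs) ys = trans (cong (ℤ._+_ (f x)) (∑-++ f xs ys)) (sym (ℤ.+-assoc (f x) _ _))

  ∑-nonneg : {f : A → ℤ} → ∀ xs → (∀ {x} → x ∈ xs → 0ℤ ℤ.≤ f x) → 0ℤ ℤ.≤ ∑ f xs
  ∑-nonneg []       0≤f = ℤ.≤-refl
  ∑-nonneg (x ∷ xs) 0≤f = ℤ.+-mono-≤ (0≤f (here refl)) (∑-nonneg xs (0≤f ∘ there))

  term≤∑ : {f : A → ℤ} → ∀ {y xs} → (∀ {x} → x ∈ xs → 0ℤ ℤ.≤ f x) → y ∈ xs → f y ℤ.≤ ∑ f xs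
  term≤∑ {f} {y} {_ ∷ xs} 0≤f (here refl) = subst (ℤ._≤ ∑ f (y ∷ xs)) (ℤ.+-identityʳ (f y))
    (ℤ.+-monoʳ-≤ (f y) (∑-nonneg xs (0≤f ∘ there)))
  term≤∑ {f} {y} {_ ∷ xs} 0≤f (there y∈xs) = subst (ℤ._≤ _) (ℤ.+-identityˡ (f y))
    (ℤ.+-mono-≤ (0≤f (here refl)) (term≤∑ (0≤f ∘ there) y∈xs))

∑-map : ∀ {A B : Set} (f : B → ℤ) (g : A → B) xs → ∑ f (map g xs) ≡ ∑ (f ∘ g) xs
∑-map f g []       = refl
∑-map f g (x ∷ xs) = cong (ℤ._+_ (f (g x))) (∑-map f g xs)

∑-cartesianProductWith : ∀ {A B C : Set} (f : C → ℤ) (g : A → B → C) xs ys →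
  ∑ f (cartesianProductWith g xs ys) ≡ ∑ (λ x → ∑ (λ y → f (g x y)) ys) xs
∑-cartesianProductWith f g []       ys = refl
∑-cartesianProductWith f g (x ∷ xs) ys = trans (∑-++ f (map (g x) ys) _)
  (cong₂ ℤ._+_ (∑-map f (g x) ys) (∑-cartesianProductWith f g xs ys))

∑-upTo-suc : ∀ f n → ∑ f (upTo (suc n)) ≡ ∑ f (upTo n) ℤ.+ f n
∑-upTo-suc f n = begin
  ∑ f (upTo (suc n))              ≡⟨ cong (∑ f) (upTo-∷ʳ n) ⟨
  ∑ f (upTo n ++ n ∷ [])          ≡⟨ ∑-++ f (upTo n) _ ⟩
  ∑ f (upTo n) ℤ.+ (f n ℤ.+ 0ℤ)   ≡⟨ cong (ℤ._+_ (∑ f (upTo n))) (ℤ.+-identityʳ (f n)) ⟩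
  ∑ f (upTo n) ℤ.+ f n ∎
  where open ≡-Reasoning

-- Second moments of the coordinate sums

3sq : ℤ → ℤ
3sq z = + 3 ℤ.* (z ℤ.* z)

-- For uniform `i` below `n`, the quantity `b + 2i` has mean `b + n - 1` and variance `(n² - 1)/3`.
-- The factor 3 in `3sq` clears this denominator.
∑-squares : ∀ b n → ∑ (λ i → 3sq (b ℤ.+ + 2 ℤ.* + i)) (upTo n)
  ≡ + n ℤ.* (3sq (b ℤ.+ + n ℤ.- 1ℤ) ℤ.+ (+ n ℤ.* + n ℤ.- 1ℤ))
∑-squares b zero    = refl
∑-squares b (suc n) = trans (∑-upTo-suc _ n) (trans (cong (ℤ._+ 3sq (b ℤ.+ + 2 ℤ.* + n)) (∑-squares b n)) (next b (+ n)))
  where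
  next : ∀ b n → n ℤ.* (+ 3 ℤ.* ((b ℤ.+ n ℤ.- 1ℤ) ℤ.* (b ℤ.+ n ℤ.- 1ℤ)) ℤ.+ (n ℤ.* n ℤ.- 1ℤ))
      ℤ.+ + 3 ℤ.* ((b ℤ.+ + 2 ℤ.* n) ℤ.* (b ℤ.+ + 2 ℤ.* n))
    ≡ (1ℤ ℤ.+ n) ℤ.* (+ 3 ℤ.* ((b ℤ.+ (1ℤ ℤ.+ n) ℤ.- 1ℤ) ℤ.* (b ℤ.+ (1ℤ ℤ.+ n) ℤ.- 1ℤ))
      ℤ.+ ((1ℤ ℤ.+ n) ℤ.* (1ℤ ℤ.+ n) ℤ.- 1ℤ))
  next = ℤ-Solver.solve-∀

-- The coordinates are independent, so their variances add up. The offset `b` is general because the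
-- induction absorbs the first coordinate into it.
∑-grid-squares : ∀ m t b → ∑ (λ x → 3sq (b ℤ.+ + 2 ℤ.* + sum x)) (grid m t)
  ≡ + (m ^ t) ℤ.* (3sq (b ℤ.+ + t ℤ.* (+ m ℤ.- 1ℤ)) ℤ.+ + t ℤ.* (+ m ℤ.* + m ℤ.- 1ℤ))
∑-grid-squares m zero b = base b (+ m)
  where
  base : ∀ b m → + 3 ℤ.* ((b ℤ.+ + 2 ℤ.* 0ℤ) ℤ.* (b ℤ.+ + 2 ℤ.* 0ℤ)) ℤ.+ 0ℤ
    ≡ 1ℤ ℤ.* (+ 3 ℤ.* ((b ℤ.+ 0ℤ ℤ.* (m ℤ.- 1ℤ)) ℤ.* (b ℤ.+ 0ℤ ℤ.* (m ℤ.- 1ℤ))) ℤ.+ 0ℤ ℤ.* (m ℤ.* m ℤ.- 1ℤ))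
  base = ℤ-Solver.solve-∀
∑-grid-squares m (suc t) b = begin
  ∑ (λ x → 3sq (b ℤ.+ + 2 ℤ.* + sum x)) (grid m (suc t))
    ≡⟨ ∑-cartesianProductWith (λ x → 3sq (b ℤ.+ + 2 ℤ.* + sum x)) _∷_ (upTo m) (grid m t) ⟩
  ∑ (λ i → ∑ (λ x → 3sq (b ℤ.+ + 2 ℤ.* + (i + sum x))) (grid m t)) (upTo m)
    ≡⟨ ∑-cong (λ i → trans (∑-cong (λ x → cong 3sq (split b i (sum x))) (grid m t))
         (trans (∑-grid-squares m t (b ℤ.+ + 2 ℤ.* + i))
           (cong (λ z → + (m ^ t) ℤ.* (3sq z ℤ.+ V)) (swap b (+ i) μ)))) (upTo m) ⟩
  ∑ (λ i → + (m ^ t) ℤ.* (3sq (b ℤ.+ μ ℤ.+ + 2 ℤ.* + i) ℤ.+ V)) (upTo m)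
    ≡⟨ ∑-* (+ (m ^ t)) _ (upTo m) ⟩
  + (m ^ t) ℤ.* ∑ (λ i → 3sq (b ℤ.+ μ ℤ.+ + 2 ℤ.* + i) ℤ.+ V) (upTo m)
    ≡⟨ cong (+ (m ^ t) ℤ.*_) (trans (∑-+ _ _ (upTo m)) (cong₂ ℤ._+_ (∑-squares (b ℤ.+ μ) m)
         (trans (∑-const V (upTo m)) (cong (λ l → + l ℤ.* V) (length-upTo m))))) ⟩
  + (m ^ t) ℤ.* (+ m ℤ.* (3sq (b ℤ.+ μ ℤ.+ + m ℤ.- 1ℤ) ℤ.+ (+ m ℤ.* + m ℤ.- 1ℤ)) ℤ.+ + m ℤ.* V)
    ≡⟨ collect (+ (m ^ t)) (+ m) b (+ t) ⟩
  (+ m ℤ.* + (m ^ t)) ℤ.* (3sq (b ℤ.+ + suc t ℤ.* (+ m ℤ.- 1ℤ)) ℤ.+ + suc t ℤ.* (+ m ℤ.* + m ℤ.- 1ℤ))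
    ≡⟨ cong (ℤ._* (3sq (b ℤ.+ + suc t ℤ.* (+ m ℤ.- 1ℤ)) ℤ.+ + suc t ℤ.* (+ m ℤ.* + m ℤ.- 1ℤ))) (ℤ.pos-* m (m ^ t)) ⟨
  + (m ^ suc t) ℤ.* (3sq (b ℤ.+ + suc t ℤ.* (+ m ℤ.- 1ℤ)) ℤ.+ + suc t ℤ.* (+ m ℤ.* + m ℤ.- 1ℤ)) ∎
  where
  open ≡-Reasoning
  μ = + t ℤ.* (+ m ℤ.- 1ℤ)
  V = + t ℤ.* (+ m ℤ.* + m ℤ.- 1ℤ)

  split : ∀ b i s → b ℤ.+ + 2 ℤ.* + (i + s) ≡ b ℤ.+ + 2 ℤ.* + i ℤ.+ + 2 ℤ.* + s
  split b i s = trans (cong (λ z → b ℤ.+ + 2 ℤ.* z) (ℤ.pos-+ i s)) (distribute b (+ i) (+ s))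
    where
    distribute : ∀ b i s → b ℤ.+ + 2 ℤ.* (i ℤ.+ s) ≡ b ℤ.+ + 2 ℤ.* i ℤ.+ + 2 ℤ.* s
    distribute = ℤ-Solver.solve-∀

  swap : ∀ b i μ → b ℤ.+ + 2 ℤ.* i ℤ.+ μ ≡ b ℤ.+ μ ℤ.+ + 2 ℤ.* i
  swap = ℤ-Solver.solve-∀

  collect : ∀ M m b t →
    M ℤ.* (m ℤ.* (+ 3 ℤ.* ((b ℤ.+ t ℤ.* (m ℤ.- 1ℤ) ℤ.+ m ℤ.- 1ℤ) ℤ.* (b ℤ.+ t ℤ.* (m ℤ.- 1ℤ) ℤ.+ m ℤ.- 1ℤ))
      ℤ.+ (m ℤ.* m ℤ.- 1ℤ)) ℤ.+ m ℤ.* (t ℤ.* (m ℤ.* m ℤ.- 1ℤ)))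
    ≡ (m ℤ.* M) ℤ.* (+ 3 ℤ.* ((b ℤ.+ (1ℤ ℤ.+ t) ℤ.* (m ℤ.- 1ℤ)) ℤ.* (b ℤ.+ (1ℤ ℤ.+ t) ℤ.* (m ℤ.- 1ℤ)))
      ℤ.+ (1ℤ ℤ.+ t) ℤ.* (m ℤ.* m ℤ.- 1ℤ))
  collect = ℤ-Solver.solve-∀

-- Layers of the grid

ifDec : {P : Set} → Dec P → ℤ → ℤ
ifDec (yes _) z = z
ifDec (no  _) z = 0ℤ

module _ {A : Set} {P : ℕ → A → Set} (P? : ∀ j x → Dec (P j x)) (w : ℕ → ℤ) (js : List ℕ) where

  -- Double counting: the sum by points and classes is regrouped by classes.
  ∑-by-class : ∀ xs → ∑ (λ x → ∑ (λ j → ifDec (P? j x) (w j)) js) xs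
    ≡ ∑ (λ j → + length (filter (P? j) xs) ℤ.* w j) js
  ∑-by-class []       = sym (trans (∑-* 0ℤ w js) (ℤ.*-zeroˡ (∑ w js)))
  ∑-by-class (x ∷ xs) = begin
    ∑ (λ j → ifDec (P? j x) (w j)) js ℤ.+ ∑ (λ x → ∑ (λ j → ifDec (P? j x) (w j)) js) xs
      ≡⟨ cong (ℤ._+_ (∑ (λ j → ifDec (P? j x) (w j)) js)) (∑-by-class xs) ⟩
    ∑ (λ j → ifDec (P? j x) (w j)) js ℤ.+ ∑ (λ j → + length (filter (P? j) xs) ℤ.* w j) js
      ≡⟨ ∑-+ _ _ js ⟨
    ∑ (λ j → ifDec (P? j x) (w j) ℤ.+ + length (filter (P? j) xs) ℤ.* w j) js
      ≡⟨ ∑-cong count js ⟩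
    ∑ (λ j → + length (filter (P? j) (x ∷ xs)) ℤ.* w j) js ∎
    where
    open ≡-Reasoning
    count : ∀ j → ifDec (P? j x) (w j) ℤ.+ + length (filter (P? j) xs) ℤ.* w j
      ≡ + length (filter (P? j) (x ∷ xs)) ℤ.* w j
    count j with P? j x
    ... | yes _ = sym (ℤ.suc-* (+ length (filter (P? j) xs)) (w j))
    ... | no  _ = ℤ.+-identityˡ _

≤-suc-cases : ∀ {P : ℕ → Set} {n} → (∀ {i} → i ≤ n → P i) → P (suc n) → ∀ {i} → i ≤ suc n → P i
≤-suc-cases below top i≤ with m≤n⇒m<n∨m≡n i≤
... | inj₁ i<   = below (≤-pred i<)
... | inj₂ refl = top

argmax : ∀ (f : ℕ → ℕ) n → ∃ λ j → ∀ {i} → i ≤ n → f i ≤ f j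
argmax f zero = 0 , λ { z≤n → ≤-refl }
argmax f (suc n) with argmax f n
... | j , max with ≤-total (f j) (f (suc n))
... | inj₁ le = suc n , ≤-suc-cases (λ i≤ → ≤-trans (max i≤) le) ≤-refl
... | inj₂ ge = j , ≤-suc-cases max ge

3sq-outside : ∀ h r → + 3 ℤ.* (+ h ℤ.* + h) ℤ.- 3sq (+ h ℤ.+ + r) ℤ.≤ 0ℤ
3sq-outside h r = ℤ.i≤j⇒i-j≤0 (begin
  + 3 ℤ.* (+ h ℤ.* + h)   ≡⟨ cong (+ 3 ℤ.*_) (ℤ.pos-* h h) ⟨
  + 3 ℤ.* + (h * h)       ≤⟨ ℤ.*-monoˡ-≤-nonNeg (+ 3) (ℤ.+≤+ (*-mono-≤ (m≤m+n h r) (m≤m+n h r))) ⟩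
  + 3 ℤ.* + ((h + r) * (h + r)) ≡⟨ cong (+ 3 ℤ.*_) (ℤ.pos-* (h + r) (h + r)) ⟩
  3sq (+ (h + r))         ≡⟨ cong 3sq (ℤ.pos-+ h r) ⟩
  3sq (+ h ℤ.+ + r) ∎)
  where open ℤ.≤-Reasoning

-- The sums 2 Σxᵢ − t m over the grid have variance t ((m + 1)² − 1) / 3.  Testing them against
-- the weight 3 (H² − y²) with H = suc h, which is positive on at most H layers, bounds the largest
-- layer from below.  The window is q ≤ Σxᵢ + H < q + H, shifted by H so that it stays in ℕ, and e
-- corrects the parity of y.
module LargeLayer (t m h q e : ℕ) (e≤1 : e ≤ 1) (parity : t * m + suc h + e ≡ 2 * q)
  (1≤t : 1 ≤ t) (h-large : t * (suc m * suc m) ≤ suc h * suc h) where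

  H = suc h
  M = suc m

  inLayer? : ∀ j (x : Vec ℕ t) → Dec (sum x + H ≡ q + j)
  inLayer? j x = sum x + H ≟ q + j

  layer : ℕ → List (Vec ℕ t)
  layer j = filter (inLayer? j) (grid M t)

  3H² : ℤ
  3H² = + 3 ℤ.* (+ H ℤ.* + H)

  weight : ℕ → ℤ
  weight s = 3H² ℤ.- 3sq (ℤ.- + (t * m) ℤ.+ + 2 ℤ.* + s)

  -- The weight on the `j`-th layer of the window: for `s + H = q + j`, the parity equation turns
  -- `2s - tm` into `e - H + 2j`.
  layerWeight : ℕ → ℤ
  layerWeight j = 3H² ℤ.- 3sq (+ e ℤ.- + H ℤ.+ + 2 ℤ.* + j)

  -- `H² - y²` factors as `(H + y)(H - y)`, that is `(e + 2j)(2H - e - 2j)`, and `e + 2j` is at most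
  -- `1 + 2h`.
  layerWeight-nonneg : ∀ {j} → j ≤ h → 0ℤ ℤ.≤ layerWeight j
  layerWeight-nonneg {j} j≤h with m≤n⇒∃[o]m+o≡n bound
    where
    bound : e + 2 * j ≤ 2 * H
    bound = ≤-trans (+-mono-≤ e≤1 (*-monoʳ-≤ 2 j≤h)) (≤-trans (n≤1+n _) (≤-reflexive (sym (*-suc 2 h))))
  ... | r , eq = subst (0ℤ ℤ.≤_) (sym (begin
    layerWeight j ≡⟨ factor (+ e) (+ H) (+ j) ⟩
    + 3 ℤ.* (a ℤ.* (+ 2 ℤ.* + H ℤ.- a)) ≡⟨ cong (λ z → + 3 ℤ.* (a ℤ.* (z ℤ.- a))) 2H ⟩
    + 3 ℤ.* (a ℤ.* (a ℤ.+ + r ℤ.- a)) ≡⟨ cong (λ z → + 3 ℤ.* (a ℤ.* z)) (cancel a (+ r)) ⟩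
    + 3 ℤ.* (a ℤ.* + r) ≡⟨ cong (λ z → + 3 ℤ.* (z ℤ.* + r)) a-pos ⟨
    + 3 ℤ.* (+ (e + 2 * j) ℤ.* + r) ≡⟨ cong (+ 3 ℤ.*_) (ℤ.pos-* (e + 2 * j) r) ⟨
    + 3 ℤ.* + ((e + 2 * j) * r) ≡⟨ ℤ.pos-* 3 ((e + 2 * j) * r) ⟨
    + (3 * ((e + 2 * j) * r)) ∎)) (ℤ.+≤+ z≤n)
    where
    open ≡-Reasoning
    a = + e ℤ.+ + 2 ℤ.* + j
    a-pos : + (e + 2 * j) ≡ a
    a-pos = trans (ℤ.pos-+ e (2 * j)) (cong (ℤ._+_ (+ e)) (ℤ.pos-* 2 j))
    2H : + 2 ℤ.* + H ≡ a ℤ.+ + r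
    2H = trans (sym (ℤ.pos-* 2 H)) (trans (cong +_ (sym eq)) (trans (ℤ.pos-+ (e + 2 * j) r) (cong (ℤ._+ + r) a-pos)))
    cancel : ∀ a r → a ℤ.+ r ℤ.- a ≡ r
    cancel = ℤ-Solver.solve-∀
    factor : ∀ e h j → + 3 ℤ.* (h ℤ.* h) ℤ.- + 3 ℤ.* ((e ℤ.- h ℤ.+ + 2 ℤ.* j) ℤ.* (e ℤ.- h ℤ.+ + 2 ℤ.* j))
      ≡ + 3 ℤ.* ((e ℤ.+ + 2 ℤ.* j) ℤ.* (+ 2 ℤ.* h ℤ.- (e ℤ.+ + 2 ℤ.* j)))
    factor = ℤ-Solver.solve-∀

  -- With `y = 2s - tm`, the parity equation gives `y ≤ -H` below the window, and likewise `y ≥ H`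
  -- above it; in both cases `y² ≥ H²`.
  weight-below : ∀ {s} → s + H < q → weight s ℤ.≤ 0ℤ
  weight-below {s} lt with m≤n⇒∃[o]m+o≡n bound
    where
    open ≤-Reasoning
    shift : ∀ s H → 2 + (s * 2 + H + H) ≡ 2 * (1 + (s + H))
    shift = solve-∀
    bound : s * 2 + H ≤ t * m
    bound = +-cancelʳ-≤ H _ _ (≤-pred (≤-trans (n≤1+n _) (begin
      2 + (s * 2 + H + H) ≡⟨ shift s H ⟩
      2 * (1 + (s + H))   ≤⟨ *-monoʳ-≤ 2 lt ⟩
      2 * q               ≡⟨ parity ⟨
      t * m + H + e       ≤⟨ +-monoʳ-≤ (t * m + H) e≤1 ⟩
      t * m + H + 1       ≡⟨ +-comm _ 1 ⟩
      suc (t * m + H) ∎)))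
  ... | r , eq = subst (λ z → 3H² ℤ.- z ℤ.≤ 0ℤ) (sym same) (3sq-outside H r)
    where
    flip : ∀ s H r → + 3 ℤ.* ((ℤ.- (s ℤ.* + 2 ℤ.+ H ℤ.+ r) ℤ.+ + 2 ℤ.* s) ℤ.* (ℤ.- (s ℤ.* + 2 ℤ.+ H ℤ.+ r) ℤ.+ + 2 ℤ.* s))
      ≡ + 3 ℤ.* ((H ℤ.+ r) ℤ.* (H ℤ.+ r))
    flip = ℤ-Solver.solve-∀
    tm : + (t * m) ≡ + s ℤ.* + 2 ℤ.+ + H ℤ.+ + r
    tm = trans (cong +_ (sym eq)) (trans (ℤ.pos-+ (s * 2 + H) r) (cong (ℤ._+ + r)
      (trans (ℤ.pos-+ (s * 2) H) (cong (ℤ._+ + H) (ℤ.pos-* s 2)))))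
    same : 3sq (ℤ.- + (t * m) ℤ.+ + 2 ℤ.* + s) ≡ 3sq (+ H ℤ.+ + r)
    same = trans (cong (λ z → 3sq (ℤ.- z ℤ.+ + 2 ℤ.* + s)) tm) (flip (+ s) (+ H) (+ r))

  weight-above : ∀ {s} → q ≤ s → weight s ℤ.≤ 0ℤ
  weight-above {s} q≤s with m≤n⇒∃[o]m+o≡n (≤-trans (m≤m+n (t * m + H) e) (≤-trans (≤-reflexive parity) (*-monoʳ-≤ 2 q≤s)))
  ... | r , eq = subst (λ z → 3H² ℤ.- z ℤ.≤ 0ℤ) (sym same) (3sq-outside H r)
    where
    drop : ∀ k H r → ℤ.- k ℤ.+ (k ℤ.+ H ℤ.+ r) ≡ H ℤ.+ r
    drop = ℤ-Solver.solve-∀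
    2s : + 2 ℤ.* + s ≡ + (t * m) ℤ.+ + H ℤ.+ + r
    2s = trans (sym (ℤ.pos-* 2 s)) (trans (cong +_ (sym eq)) (trans (ℤ.pos-+ (t * m + H) r) (cong (ℤ._+ + r) (ℤ.pos-+ (t * m) H))))
    same : 3sq (ℤ.- + (t * m) ℤ.+ + 2 ℤ.* + s) ≡ 3sq (+ H ℤ.+ + r)
    same = cong 3sq (trans (cong (ℤ._+_ (ℤ.- + (t * m))) 2s) (drop (+ (t * m)) (+ H) (+ r)))

  weight-inside : ∀ {s j} → s + H ≡ q + j → weight s ≡ layerWeight j
  weight-inside {s} {j} eq = cong (λ z → 3H² ℤ.- 3sq z) (begin
    ℤ.- k ℤ.+ + 2 ℤ.* + s                        ≡⟨ expand k (+ s) (+ H) ⟩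
    ℤ.- k ℤ.+ + 2 ℤ.* (+ s ℤ.+ + H) ℤ.- + 2 ℤ.* + H ≡⟨ cong (λ z → ℤ.- k ℤ.+ + 2 ℤ.* z ℤ.- + 2 ℤ.* + H) eqℤ ⟩
    ℤ.- k ℤ.+ + 2 ℤ.* (+ q ℤ.+ + j) ℤ.- + 2 ℤ.* + H ≡⟨ regroup k (+ q) (+ j) (+ H) ⟩
    ℤ.- k ℤ.+ + 2 ℤ.* + q ℤ.+ + 2 ℤ.* + j ℤ.- + 2 ℤ.* + H ≡⟨ cong (λ z → ℤ.- k ℤ.+ z ℤ.+ + 2 ℤ.* + j ℤ.- + 2 ℤ.* + H) 2q ⟩
    ℤ.- k ℤ.+ (k ℤ.+ + H ℤ.+ + e) ℤ.+ + 2 ℤ.* + j ℤ.- + 2 ℤ.* + H ≡⟨ simplify k (+ H) (+ e) (+ j) ⟩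
    + e ℤ.- + H ℤ.+ + 2 ℤ.* + j ∎)
    where
    open ≡-Reasoning
    k = + (t * m)
    eqℤ : + s ℤ.+ + H ≡ + q ℤ.+ + j
    eqℤ = trans (sym (ℤ.pos-+ s H)) (trans (cong +_ eq) (ℤ.pos-+ q j))
    2q : + 2 ℤ.* + q ≡ k ℤ.+ + H ℤ.+ + e
    2q = trans (sym (ℤ.pos-* 2 q)) (trans (cong +_ (sym parity)) (trans (ℤ.pos-+ (t * m + H) e) (cong (ℤ._+ + e) (ℤ.pos-+ (t * m) H))))
    expand : ∀ k s H → ℤ.- k ℤ.+ + 2 ℤ.* s ≡ ℤ.- k ℤ.+ + 2 ℤ.* (s ℤ.+ H) ℤ.- + 2 ℤ.* H
    expand = ℤ-Solver.solve-∀
    regroup : ∀ k q j H → ℤ.- k ℤ.+ + 2 ℤ.* (q ℤ.+ j) ℤ.- + 2 ℤ.* H ≡ ℤ.- k ℤ.+ + 2 ℤ.* q ℤ.+ + 2 ℤ.* j ℤ.- + 2 ℤ.* H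
    regroup = ℤ-Solver.solve-∀
    simplify : ∀ k H e j → ℤ.- k ℤ.+ (k ℤ.+ H ℤ.+ e) ℤ.+ + 2 ℤ.* j ℤ.- + 2 ℤ.* H ≡ e ℤ.- H ℤ.+ + 2 ℤ.* j
    simplify = ℤ-Solver.solve-∀

  layerTerm : Vec ℕ t → ℕ → ℤ
  layerTerm x j = ifDec (inLayer? j x) (layerWeight j)

  layerTerm-nonneg : ∀ x {j} → j ∈ upTo H → 0ℤ ℤ.≤ layerTerm x j
  layerTerm-nonneg x {j} j∈ with inLayer? j x
  ... | yes _ = layerWeight-nonneg (≤-pred (∈-upTo⁻ j∈))
  ... | no  _ = ℤ.≤-refl

  layerTerm-inside : ∀ x {j} → sum x + H ≡ q + j → layerTerm x j ≡ layerWeight j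
  layerTerm-inside x {j} eq with inLayer? j x
  ... | yes _  = refl
  ... | no neq = contradiction eq neq

  -- Inside the window the weight is one of the nonnegative terms; outside it the weight is at most
  -- 0.
  weight≤∑layerTerm : ∀ x → weight (sum x) ℤ.≤ ∑ (layerTerm x) (upTo H)
  weight≤∑layerTerm x with q ≤? sum x + H
  ... | no q≰ = ℤ.≤-trans (weight-below (≰⇒> q≰)) (∑-nonneg (upTo H) (layerTerm-nonneg x))
  ... | yes q≤ with m≤n⇒∃[o]m+o≡n q≤
  ... | j , eq with j <? H
  ... | yes j<H = subst (ℤ._≤ _)
    (trans (layerTerm-inside x (sym eq)) (sym (weight-inside (sym eq))))
    (term≤∑ (layerTerm-nonneg x) (∈-upTo⁺ j<H))
  ... | no j≮H = ℤ.≤-trans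
    (weight-above (+-cancelʳ-≤ H q (sum x) (≤-trans (+-monoʳ-≤ q (≮⇒≥ j≮H)) (≤-reflexive eq))))
    (∑-nonneg (upTo H) (layerTerm-nonneg x))

  largest : ∃ λ j → ∀ {i} → i ≤ h → length (layer i) ≤ length (layer j)
  largest = argmax (length ∘ layer) h

  A : ℕ
  A = length (layer (proj₁ largest))

  -- `H * C` is the total of the layer weights for `e = 1`; for `e = 0` that total is smaller by
  -- `3H`. The successor form makes `C` visibly positive when it is cancelled.
  C : ℤ
  C = + suc (2 * (H * H))

  C≡ : C ≡ 1ℤ ℤ.+ + 2 ℤ.* (+ H ℤ.* + H)
  C≡ = cong (ℤ._+_ 1ℤ) (trans (ℤ.pos-* 2 (H * H)) (cong (+ 2 ℤ.*_) (ℤ.pos-* H H)))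

  total-weight : ∑ (weight ∘ sum) (grid M t) ≡ + (M ^ t) ℤ.* (3H² ℤ.- + t ℤ.* (+ M ℤ.* + M ℤ.- 1ℤ))
  total-weight = begin
    ∑ (weight ∘ sum) (grid M t)
      ≡⟨ ∑-const-minus 3H² _ (grid M t) ⟩
    + length (grid M t) ℤ.* 3H² ℤ.- ∑ (λ x → 3sq (ℤ.- + (t * m) ℤ.+ + 2 ℤ.* + sum x)) (grid M t)
      ≡⟨ cong₂ (λ l z → + l ℤ.* 3H² ℤ.- z) (length-grid M t) (∑-grid-squares M t (ℤ.- + (t * m))) ⟩
    + (M ^ t) ℤ.* 3H² ℤ.- + (M ^ t) ℤ.* (3sq (ℤ.- + (t * m) ℤ.+ + t ℤ.* (+ M ℤ.- 1ℤ)) ℤ.+ V)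
      ≡⟨ cong (λ z → + (M ^ t) ℤ.* 3H² ℤ.- + (M ^ t) ℤ.* (3sq z ℤ.+ V)) centred ⟩
    + (M ^ t) ℤ.* 3H² ℤ.- + (M ^ t) ℤ.* (3sq 0ℤ ℤ.+ V)
      ≡⟨ factor (+ (M ^ t)) 3H² V ⟩
    + (M ^ t) ℤ.* (3H² ℤ.- V) ∎
    where
    open ≡-Reasoning
    V = + t ℤ.* (+ M ℤ.* + M ℤ.- 1ℤ)
    factor : ∀ T H V → T ℤ.* H ℤ.- T ℤ.* (+ 3 ℤ.* (0ℤ ℤ.* 0ℤ) ℤ.+ V) ≡ T ℤ.* (H ℤ.- V)
    factor = ℤ-Solver.solve-∀
    vanish : ∀ t m → ℤ.- (t ℤ.* m) ℤ.+ t ℤ.* (1ℤ ℤ.+ m ℤ.- 1ℤ) ≡ 0ℤ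
    vanish = ℤ-Solver.solve-∀
    centred : ℤ.- + (t * m) ℤ.+ + t ℤ.* (+ M ℤ.- 1ℤ) ≡ 0ℤ
    centred = trans (cong (λ z → ℤ.- z ℤ.+ + t ℤ.* (+ M ℤ.- 1ℤ)) (ℤ.pos-* t m)) (vanish (+ t) (+ m))

  ∑layerWeight-≤ : ∑ layerWeight (upTo H) ℤ.≤ + H ℤ.* C
  ∑layerWeight-≤ = begin
    ∑ layerWeight (upTo H)
      ≡⟨ ∑-const-minus 3H² (λ j → 3sq (+ e ℤ.- + H ℤ.+ + 2 ℤ.* + j)) (upTo H) ⟩
    + length (upTo H) ℤ.* 3H² ℤ.- ∑ (λ j → 3sq (+ e ℤ.- + H ℤ.+ + 2 ℤ.* + j)) (upTo H)
      ≡⟨ cong₂ (λ l z → + l ℤ.* 3H² ℤ.- z) (length-upTo H) (∑-squares (+ e ℤ.- + H) H) ⟩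
    + H ℤ.* 3H² ℤ.- + H ℤ.* (3sq (+ e ℤ.- + H ℤ.+ + H ℤ.- 1ℤ) ℤ.+ (+ H ℤ.* + H ℤ.- 1ℤ))
      ≤⟨ bound e≤1 ⟩
    + H ℤ.* (1ℤ ℤ.+ + 2 ℤ.* (+ H ℤ.* + H))
      ≡⟨ cong (+ H ℤ.*_) C≡ ⟨
    + H ℤ.* C ∎
    where
    open ℤ.≤-Reasoning
    bound₁ : ∀ H → H ℤ.* (+ 3 ℤ.* (H ℤ.* H))
        ℤ.- H ℤ.* (+ 3 ℤ.* ((1ℤ ℤ.- H ℤ.+ H ℤ.- 1ℤ) ℤ.* (1ℤ ℤ.- H ℤ.+ H ℤ.- 1ℤ)) ℤ.+ (H ℤ.* H ℤ.- 1ℤ))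
      ≡ H ℤ.* (1ℤ ℤ.+ + 2 ℤ.* (H ℤ.* H))
    bound₁ = ℤ-Solver.solve-∀
    bound₀ : ∀ H → H ℤ.* (+ 3 ℤ.* (H ℤ.* H))
        ℤ.- H ℤ.* (+ 3 ℤ.* ((0ℤ ℤ.- H ℤ.+ H ℤ.- 1ℤ) ℤ.* (0ℤ ℤ.- H ℤ.+ H ℤ.- 1ℤ)) ℤ.+ (H ℤ.* H ℤ.- 1ℤ))
      ≡ H ℤ.* (1ℤ ℤ.+ + 2 ℤ.* (H ℤ.* H)) ℤ.- + 3 ℤ.* H
    bound₀ = ℤ-Solver.solve-∀
    bound : ∀ {e} → e ≤ 1 →
      + H ℤ.* 3H² ℤ.- + H ℤ.* (3sq (+ e ℤ.- + H ℤ.+ + H ℤ.- 1ℤ) ℤ.+ (+ H ℤ.* + H ℤ.- 1ℤ))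
      ℤ.≤ + H ℤ.* (1ℤ ℤ.+ + 2 ℤ.* (+ H ℤ.* + H))
    bound z≤n       = ℤ.≤-trans (ℤ.≤-reflexive (bound₀ (+ H))) (ℤ.i-j≤i _ (+ 3 ℤ.* + H))
    bound (s≤s z≤n) = ℤ.≤-reflexive (bound₁ (+ H))

  -- This is where the size of `H` matters: `H² ≥ tM²` turns `3H² - tM² + t` into at least
  -- `2H² + t`, and `t ≥ 1` does the rest.
  C-≤ : C ℤ.≤ 3H² ℤ.- + t ℤ.* (+ M ℤ.* + M ℤ.- 1ℤ)
  C-≤ = begin
    C                                                     ≡⟨ C≡ ⟩
    1ℤ ℤ.+ + 2 ℤ.* H²                                     ≡⟨ expand H² ⟩
    + 3 ℤ.* H² ℤ.+ (1ℤ ℤ.- H²)                            ≤⟨ ℤ.+-monoʳ-≤ 3H² (ℤ.+-mono-≤ (ℤ.+≤+ 1≤t) (ℤ.neg-mono-≤ τ≤H²)) ⟩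
    + 3 ℤ.* H² ℤ.+ (+ t ℤ.- τ)                            ≡⟨ collect 3H² (+ t) (+ M) ⟩
    3H² ℤ.- + t ℤ.* (+ M ℤ.* + M ℤ.- 1ℤ) ∎
    where
    open ℤ.≤-Reasoning
    H² = + H ℤ.* + H
    τ = + t ℤ.* (+ M ℤ.* + M)
    τ≤H² : τ ℤ.≤ H²
    τ≤H² = subst₂ ℤ._≤_ (trans (ℤ.pos-* t (M * M)) (cong (+ t ℤ.*_) (ℤ.pos-* M M))) (ℤ.pos-* H H) (ℤ.+≤+ h-large)
    expand : ∀ x → 1ℤ ℤ.+ + 2 ℤ.* x ≡ + 3 ℤ.* x ℤ.+ (1ℤ ℤ.- x)
    expand = ℤ-Solver.solve-∀
    collect : ∀ x t M → x ℤ.+ (t ℤ.- t ℤ.* (M ℤ.* M)) ≡ x ℤ.- t ℤ.* (M ℤ.* M ℤ.- 1ℤ)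
    collect = ℤ-Solver.solve-∀

  -- The average weight of a grid point is at least `C`, while the layers of the window, each with
  -- at most `A` points, contribute at most `A * H * C` altogether. Cancelling `C` leaves the bound.
  largest-layer-bound : M ^ t ≤ A * H
  largest-layer-bound = ℤ.drop‿+≤+ (subst (+ (M ^ t) ℤ.≤_) (sym (ℤ.pos-* A H))
    (ℤ.*-cancelʳ-≤-pos (+ (M ^ t)) (+ A ℤ.* + H) C (begin
      + (M ^ t) ℤ.* C
        ≤⟨ ℤ.*-monoˡ-≤-nonNeg (+ (M ^ t)) C-≤ ⟩
      + (M ^ t) ℤ.* (3H² ℤ.- + t ℤ.* (+ M ℤ.* + M ℤ.- 1ℤ))
        ≡⟨ total-weight ⟨
      ∑ (weight ∘ sum) (grid M t)
        ≤⟨ ∑-mono (grid M t) (λ {x} _ → weight≤∑layerTerm x) ⟩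
      ∑ (λ x → ∑ (layerTerm x) (upTo H)) (grid M t)
        ≡⟨ ∑-by-class inLayer? layerWeight (upTo H) (grid M t) ⟩
      ∑ (λ j → + length (layer j) ℤ.* layerWeight j) (upTo H)
        ≤⟨ ∑-mono (upTo H) (λ j∈ → layer-≤ (≤-pred (∈-upTo⁻ j∈))) ⟩
      ∑ (λ j → + A ℤ.* layerWeight j) (upTo H)
        ≡⟨ ∑-* (+ A) layerWeight (upTo H) ⟩
      + A ℤ.* ∑ layerWeight (upTo H)
        ≤⟨ ℤ.*-monoˡ-≤-nonNeg (+ A) ∑layerWeight-≤ ⟩
      + A ℤ.* (+ H ℤ.* C)
        ≡⟨ ℤ.*-assoc (+ A) (+ H) C ⟨
      + A ℤ.* + H ℤ.* C ∎)))
    where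
    open ℤ.≤-Reasoning
    layer-≤ : ∀ {j} → j ≤ h → + length (layer j) ℤ.* layerWeight j ℤ.≤ + A ℤ.* layerWeight j
    layer-≤ {j} j≤h = ℤ.*-monoʳ-≤-nonNeg (layerWeight j) {{ℤ.nonNegative (layerWeight-nonneg j≤h)}}
      (ℤ.+≤+ (proj₂ largest j≤h))

  builder-needs : ∀ {n} → BuilderWinsIn t M n [] → A ≤ 2 * n
  -- Truncated subtraction is harmless: any point `x` of the layer satisfies `sum x + H ≡ q + j`.
  builder-needs = antichain-bound {s = q + j ∸ H} (layer j) (Unique.filter⁺ (inLayer? j) (grid-unique M t)) λ {x} x∈ →
    let x∈grid , eq = ∈-filter⁻ (inLayer? j) {xs = grid M t} x∈
    in ∈grid⇒bounded x∈grid , trans (sym (m+n∸n≡m (sum x) H)) (cong (_∸ H) eq)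
    where j = proj₁ largest

-- Parity, square roots and the final bounds

even-or-odd : ∀ n → ∃₂ λ q e → e ≤ 1 × n + e ≡ 2 * q
even-or-odd zero = 0 , 0 , z≤n , refl
even-or-odd (suc n) with even-or-odd n
... | q , zero , _ , eq = suc q , 1 , ≤-refl , trans (cong suc (+-suc n 0)) (trans (cong (λ z → suc (suc z)) eq) (sym (*-suc 2 q)))
... | q , suc zero , _ , eq = q , 0 , z≤n , trans (cong suc (+-identityʳ n)) (trans (sym (+-comm n 1)) eq)
... | q , suc (suc e) , s≤s () , eq

-- The witness is suc h = ⌈√n⌉.
ceil-sqrt : ∀ n → 5 ≤ n → ∃ λ h → n ≤ suc h * suc h × 4 * (suc h * suc h) ≤ 9 * n
ceil-sqrt n 5≤n with least (λ h → n ≤? h * h) {n} (m≤m*n n n {{>-nonZero (≤-trans (s≤s z≤n) 5≤n)}})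
... | 0 , n≤ , _ = contradiction (≤-trans 5≤n n≤) λ ()
... | 1 , n≤ , _ = contradiction (≤-trans 5≤n n≤) λ { (s≤s ()) }
... | 2 , n≤ , _ = contradiction (≤-trans 5≤n n≤) λ { (s≤s (s≤s (s≤s (s≤s ())))) }
-- The root `suc h` is at least 3, hence at most `3h/2`, and minimality gives `h² < n`.
... | suc h@(suc (suc k)) , n≤ , minimal = h , n≤ , (begin
  4 * (suc h * suc h)            ≡⟨ square-2 (suc h) ⟩
  (2 * suc h) * (2 * suc h)      ≤⟨ *-mono-≤ 2h≤3h 2h≤3h ⟩
  (3 * h) * (3 * h)              ≡⟨ square-3 h ⟩
  9 * (h * h)                    ≤⟨ *-monoʳ-≤ 9 (<⇒≤ (≰⇒> λ n≤h² → <-irrefl refl (minimal h n≤h²))) ⟩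
  9 * n ∎)
  where
  open ≤-Reasoning
  square-2 : ∀ x → 4 * (x * x) ≡ (2 * x) * (2 * x)
  square-2 = solve-∀
  square-3 : ∀ x → (3 * x) * (3 * x) ≡ 9 * (x * x)
  square-3 = solve-∀
  expand : ∀ k → 2 * (3 + k) + k ≡ 3 * (2 + k)
  expand = solve-∀
  2h≤3h : 2 * suc h ≤ 3 * h
  2h≤3h = ≤-trans (m≤m+n _ k) (≤-reflexive (expand k))

-- Since `H` is at most `(3/2) M √T`, the layer bound becomes `M^T ≤ 2RH ≤ 3RM√T`. Squaring removes
-- the root, and `M²` cancels.
painter-bound : ∀ t m R → 2 ≤ suc t → 2 ≤ suc m → BuilderWinsIn (suc t) (suc m) R [] →
  suc m ^ (2 * t) ≤ 9 * suc t * (R * R)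
painter-bound t m R 2≤t 2≤m wins with ceil-sqrt (suc t * (suc m * suc m))
  (≤-trans (s≤s (s≤s (s≤s (s≤s (s≤s z≤n))))) (*-mono-≤ 2≤t (*-mono-≤ 2≤m 2≤m)))
... | h , h-large , h-small with even-or-odd (suc t * m + suc h)
... | q , e , e≤1 , parity = *-cancelʳ-≤ _ _ (M * M) (begin
  M ^ (2 * t) * (M * M)             ≡⟨ cong (_* (M * M)) (trans (cong (M ^_) (cong (_+_ t) (+-identityʳ t))) (^-distribˡ-+-* M t t)) ⟩
  M ^ t * M ^ t * (M * M)           ≡⟨ rearrange (M ^ t) M ⟩
  M ^ T * M ^ T                     ≤⟨ *-mono-≤ bound bound ⟩
  (2 * R * H) * (2 * R * H)         ≡⟨ square R H ⟩
  R * R * (4 * (H * H))             ≤⟨ *-monoʳ-≤ (R * R) h-small ⟩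
  R * R * (9 * (T * (M * M)))       ≡⟨ regroup R T M ⟩
  9 * T * (R * R) * (M * M) ∎)
  where
  open ≤-Reasoning
  open LargeLayer (suc t) m h q e e≤1 parity (s≤s z≤n) h-large
  T = suc t
  bound : M ^ T ≤ 2 * R * H
  bound = ≤-trans largest-layer-bound (*-monoˡ-≤ H (builder-needs wins))
  rearrange : ∀ x M → x * x * (M * M) ≡ (M * x) * (M * x)
  rearrange = solve-∀
  square : ∀ R H → (2 * R * H) * (2 * R * H) ≡ R * R * (4 * (H * H))
  square = solve-∀
  regroup : ∀ R T M → R * R * (9 * (T * (M * M))) ≡ 9 * T * (R * R) * (M * M)
  regroup = solve-∀

theorem2 : (t r : ℕ) → 2 ≤ t → 3 ≤ r →
    ∃ λ R → IsOnlineRamseyPath t (r ∸ 1) R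
    × ((r ∸ 1) ^ (2 * (t ∸ 1)) ≤ 9 * t * (R * R))
    × (R ≤ t * (r ∸ 1) ^ (t + 1))
-- Builder's explicit strategy is a witness for the search, and minimality of `R` compares it with
-- that same strategy.
theorem2 (suc t) (suc (suc m)) 2≤t (s≤s 2≤m) with least (builderWins? (suc t) (suc m)) (builder-bound t m)
... | R , wins , minimal =
  R , (wins , minimal) , painter-bound t m R 2≤t 2≤m wins , minimal _ (builder-bound t m)
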